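{- Let $d_1<d_2<\cdots$ be the elements of $D$ and $u_1<u_2<\cdots$ the elements of $U$ in increasing order. Then \[\{d_{k+1}-d_k:k\ge1\}=\{u_{k+1}-u_k:k\ge1\}=\{1,2,3,5\}.\]
   Context: $\phi=(1+\sqrt5)/2$. For positive integers $a_1,a_2$, the $(a_1,a_2)$-Fibonacci walk is $w_k=w_k(a_1,a_2)$ with $w_1=a_1$, $w_2=a_2$, $w_{k+2}=w_{k+1}+w_k$. Let $s(n;a_1,a_2)$ be the integer $s$ with $w_s(a_1,a_2)=n$ ($-\infty$ if none), and $s(n)=\max_{a_1,a_2\ge1}s(n;a_1,a_2)$. A pair $(a_1,a_2)$ is $n$-good if $a_1,a_2\ge1$ and $s(n;a_1,a_2)=s(n)$; its walk is then an $n$-slow Fibonacci walk. An integer $n\ge2$ is in $D$ (down-integer) if $w_{s(n)+1}=\lfloor\phi n\rfloor$ for some $n$-slow walk, and in $U$ (up-integer) if $w_{s(n)+1}=\lceil\phi n\rceil$ for some $n$-slow walk. -}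

module Defs where

open import Data.Nat using (ℕ; zero; suc; _+_; _*_; _∸_; _^_; _≤_; _<_)
open import Data.Product using (Σ; ∃; _×_; _,_)
open import Data.Sum using (_⊎_)
open import Relation.Nullary using (¬_)
open import Relation.Binary.PropositionalEquality using (_≡_)

-- The (a₁,a₂)-Fibonacci walk, 1-indexed: walk a₁ a₂ 1 = a₁, walk a₁ a₂ 2 = a₂,
-- walk a₁ a₂ (k+2) = walk a₁ a₂ (k+1) + walk a₁ a₂ k.  Index 0 is junk (never used).
walk : ℕ → ℕ → ℕ → ℕ
walk a₁ a₂ zero = 0
walk a₁ a₂ (suc zero) = a₁
walk a₁ a₂ (suc (suc zero)) = a₂
walk a₁ a₂ (suc (suc (suc k))) = walk a₁ a₂ (suc (suc k)) + walk a₁ a₂ (suc k)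

IsSlowLength : ℕ → ℕ → Set
IsSlowLength n s =
  (Σ ℕ λ a₁ → Σ ℕ λ a₂ → 1 ≤ a₁ × 1 ≤ a₂ × 1 ≤ s × walk a₁ a₂ s ≡ n)
  × (∀ a₁ a₂ k → 1 ≤ a₁ → 1 ≤ a₂ → 1 ≤ k → walk a₁ a₂ k ≡ n → k ≤ s)

IsGood : ℕ → ℕ → ℕ → ℕ → Set
IsGood n s a₁ a₂ = 1 ≤ a₁ × 1 ≤ a₂ × walk a₁ a₂ s ≡ n

-- m = ⌊φ n⌋, for n ≥ 1, where φ = (1+√5)/2:  m ≤ φ n < m + 1,
-- i.e. 2m - n ≤ √5 n < 2(m+1) - n, squared (truncated subtraction handles signs).
IsFloorPhi : ℕ → ℕ → Set
IsFloorPhi n m = ((2 * m ∸ n) ^ 2 ≤ 5 * n ^ 2) × (5 * n ^ 2 < (2 * suc m ∸ n) ^ 2)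

-- c = ⌈φ n⌉, for n ≥ 1:  c - 1 < φ n ≤ c.
IsCeilPhi : ℕ → ℕ → Set
IsCeilPhi n c = ((2 * (c ∸ 1) ∸ n) ^ 2 < 5 * n ^ 2) × (5 * n ^ 2 ≤ (2 * c ∸ n) ^ 2)

InD : ℕ → Set
InD n = 2 ≤ n × (Σ ℕ λ s → IsSlowLength n s ×
          (Σ ℕ λ a₁ → Σ ℕ λ a₂ → IsGood n s a₁ a₂ × IsFloorPhi n (walk a₁ a₂ (suc s))))

InU : ℕ → Set
InU n = 2 ≤ n × (Σ ℕ λ s → IsSlowLength n s ×
          (Σ ℕ λ a₁ → Σ ℕ λ a₂ → IsGood n s a₁ a₂ × IsCeilPhi n (walk a₁ a₂ (suc s))))

-- P is unbounded (so its increasing enumeration p₁ < p₂ < ⋯ is infinite)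
Unbounded : (ℕ → Set) → Set
Unbounded P = ∀ m → Σ ℕ λ n → m < n × P n

IsConsecutiveGap : (ℕ → Set) → ℕ → Set
IsConsecutiveGap P g =
  1 ≤ g × (Σ ℕ λ x → P x × P (x + g) × (∀ z → x < z → z < x + g → ¬ P z))

In1235 : ℕ → Set
In1235 g = g ≡ 1 ⊎ g ≡ 2 ⊎ g ≡ 3 ⊎ g ≡ 5

{-# OPTIONS --safe #-}
module Submission where

-- Write p = F(s-2), q = F(s-1), so that w_s = a p + b q for the walk starting with (a , b).  A longest
-- walk for n has b ≤ a (otherwise prepend b - a), and conversely a walk with b ≤ a ≤ q is longest.  Since
-- w_{s+1} - φ w_s = (-1/φ)^(s-2) (a - b/φ), the longest walk with a ≤ q continues to ⌊φn⌋ or ⌈φn⌉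
-- according to the parity of s, while a longest walk with a > q misses both.  Relaxing b ≤ a to b < φa
-- only lets s vary by multiples of 2.  So n ∈ D iff n = a p + b q with 1 ≤ a ≤ q and 1 ≤ b < φa for some
-- odd s, and n ∈ U iff this holds for some even s.
--
-- Adding 1, 2, 3 or 5 to n moves (a , b) by a pair of much smaller Fibonacci numbers.  At the smallest
-- admissible s this shows that n + 3 or n + 5 is in the same class as n.  If n and n + 4 are both in the
-- class, comparing the roundings of φn and φ(n + 4) puts n + 2 or n + 3 in it.  Hence no gap is 4 or
-- exceeds 5, and small numbers realise the gaps 1, 2, 3, 5.

open import Defs
open import Data.Nat
open import Data.Nat.Properties
open import Data.Nat.Divisibility using (_∣_; divides; ∣-trans; ∣n⇒∣m*n; ∣m+n∣m⇒∣n; ∣⇒≤)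
open import Data.Nat.Tactic.RingSolver using (solve-∀; solve)
open import Data.List.Base using ([]; _∷_)
open import Data.Product using (Σ; ∃; _×_; _,_; proj₁; proj₂)
open import Data.Sum using (_⊎_; inj₁; inj₂)
open import Function.Bundles using (_⇔_; mk⇔)
open import Relation.Nullary using (¬_; Dec; yes; no; contradiction)
open import Relation.Nullary.Decidable using (map′; True; toWitness)
open import Relation.Binary.PropositionalEquality using (_≡_; _≢_; refl; sym; trans; cong; cong₂; subst; subst₂; module ≡-Reasoning)

-- Inequalities without subtraction.

-- Checks a linear inequality: A ≤ B is a sum of hypotheses and k is the slack.
≤-cert : ∀ {A B x y} k → A ≤ B → y + A ≡ x + B + k → x ≤ y
≤-cert {A} {B} {x} {y} k A≤B eq = +-cancelʳ-≤ A x y (begin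
  x + A      ≤⟨ +-monoʳ-≤ x A≤B ⟩
  x + B      ≤⟨ m≤m+n (x + B) k ⟩
  x + B + k  ≡⟨ eq ⟨
  y + A      ∎)
  where open ≤-Reasoning

balance : ∀ {M N X Y} → N + Y ≡ M + X → Y < X → M < N
balance {M} {N} {X} {Y} eq Y<X = +-cancelʳ-< Y M N (begin-strict
  M + Y  <⟨ +-monoʳ-< M Y<X ⟩
  M + X  ≡⟨ eq ⟨
  N + Y  ∎)
  where open ≤-Reasoning

split≤ : ∀ {m n} → m ≤ n → ∃ λ o → n ≡ m + o
split≤ m≤n = let (o , eq) = m≤n⇒∃[o]m+o≡n m≤n in o , sym eq

-- Comparison of fractions with the golden ratio.

-- y < φ x and y > φ x.
record Below (x y : ℕ) : Set where
  constructor below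
  field ineq : y * y < x * x + x * y

record Above (x y : ℕ) : Set where
  constructor above
  field ineq : x * x + x * y < y * y

below? : ∀ x y → Dec (Below x y)
below? x y = map′ below Below.ineq (y * y <? x * x + x * y)

¬below∧above : ∀ {x y} → Below x y → ¬ Above x y
¬below∧above (below p) (above q) = <-asym p q

≤⇒below : ∀ {x y} → 1 ≤ x → y ≤ x → Below x y
≤⇒below {x} {y} 1≤x y≤x = below (begin-strict
  y * y          ≤⟨ *-monoˡ-≤ y y≤x ⟩
  x * y          <⟨ m<n+m (x * y) (*-mono-≤ 1≤x 1≤x) ⟩
  x * x + x * y  ∎)
  where open ≤-Reasoning

above⇒≤ : ∀ {x y} → 1 ≤ x → Above x y → x ≤ y
above⇒≤ {x} {y} 1≤x ab with ≤-total x y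
... | inj₁ x≤y = x≤y
... | inj₂ y≤x = contradiction ab (¬below∧above (≤⇒below 1≤x y≤x))

-- With y = x + f, the condition y² < x² + x y becomes f y < x². Relative to x, both factors on the
-- left grow with the slope y / x, so slopes can be compared factor by factor.
square-split : ∀ x f → x * x + x * (x + f) + f * (x + f) ≡ (x + f) * (x + f) + x * x
square-split = solve-∀

below⇒excess : ∀ x f → Below x (x + f) → f * (x + f) < x * x
below⇒excess x f (below h) = balance (trans (+-comm (x * x) _) (trans (sym (square-split x f)) (+-comm _ (f * (x + f))))) h

excess⇒below : ∀ x f → f * (x + f) < x * x → Below x (x + f)
excess⇒below x f h = below (balance (square-split x f) h)

above⇒excess : ∀ x f → Above x (x + f) → x * x < f * (x + f)
above⇒excess x f (above h) = balance (trans (+-comm (f * (x + f)) _) (trans (square-split x f) (+-comm _ (x * x)))) h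

excess⇒above : ∀ x f → x * x < f * (x + f) → Above x (x + f)
excess⇒above x f h = above (balance (sym (square-split x f)) h)

below-ratio : ∀ {x y x′ y′} → 1 ≤ x′ → Below x y → y′ * x ≤ y * x′ → Below x′ y′
below-ratio {x} {y} {x′} {y′} 1≤x′ bel h with ≤-total y′ x′
... | inj₁ y′≤x′ = ≤⇒below 1≤x′ y′≤x′
... | inj₂ x′≤y′ with split≤ x′≤y′
... | e , refl with split≤ {x} {y} (*-cancelʳ-≤ x y x′ {{>-nonZero 1≤x′}} (begin
        x * x′        ≤⟨ m≤m+n (x * x′) (e * x) ⟩
        x * x′ + e * x ≡⟨ solve (x ∷ x′ ∷ e ∷ []) ⟩
        (x′ + e) * x  ≤⟨ h ⟩
        y * x′        ∎))
  where open ≤-Reasoning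
-- Scaling by x² lets the cross-multiplied comparisons of the excesses and of the second coordinates
-- be multiplied together.
... | f , refl = excess⇒below x′ e (*-cancelˡ-< (x * x) _ _ (begin-strict
    x * x * (e * (x′ + e))      ≡⟨ solve (x ∷ x′ ∷ e ∷ []) ⟩
    e * x * ((x′ + e) * x)      ≤⟨ *-mono-≤ ex≤fx′ h ⟩
    f * x′ * ((x + f) * x′)     ≡⟨ solve (x ∷ x′ ∷ f ∷ []) ⟩
    f * (x + f) * (x′ * x′)     <⟨ *-monoˡ-< (x′ * x′) {{>-nonZero (*-mono-≤ 1≤x′ 1≤x′)}} (below⇒excess x f bel) ⟩
    x * x * (x′ * x′)           ∎))
  where
  open ≤-Reasoning
  ex≤fx′ : e * x ≤ f * x′
  ex≤fx′ = ≤-cert 0 h (solve (e ∷ x ∷ f ∷ x′ ∷ []))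

above-ratio : ∀ {x y x′ y′} → 1 ≤ x → 1 ≤ x′ → Above x y → x′ * y ≤ y′ * x → Above x′ y′
above-ratio {x} {y} {x′} {y′} 1≤x 1≤x′ abo h with split≤ (above⇒≤ 1≤x abo)
... | f , refl with split≤ {x′} {y′} (*-cancelʳ-≤ x′ y′ x {{>-nonZero 1≤x}} (≤-trans (*-monoʳ-≤ x′ (m≤m+n x f)) h))
... | e , refl = excess⇒above x′ e (*-cancelˡ-< (x * x) _ _ (begin-strict
    x * x * (x′ * x′)           <⟨ *-monoˡ-< (x′ * x′) {{>-nonZero (*-mono-≤ 1≤x′ 1≤x′)}} (above⇒excess x f abo) ⟩
    f * (x + f) * (x′ * x′)     ≡⟨ solve (x ∷ x′ ∷ f ∷ []) ⟩
    x′ * f * (x′ * (x + f))     ≤⟨ *-mono-≤ x′f≤ex h ⟩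
    e * x * ((x′ + e) * x)      ≡⟨ solve (x ∷ x′ ∷ e ∷ []) ⟩
    x * x * (e * (x′ + e))      ∎))
  where
  open ≤-Reasoning
  x′f≤ex : x′ * f ≤ e * x
  x′f≤ex = ≤-cert 0 h (solve (e ∷ x ∷ f ∷ x′ ∷ []))

below-mediant : ∀ {x y x′ y′} → 1 ≤ x → Below x y → Below x′ y′ → Below (x + x′) (y + y′)
below-mediant {x} {y} {x′} {y′} 1≤x bel bel′ with ≤-total (y′ * x) (y * x′)
... | inj₁ h = below-ratio (≤-trans 1≤x (m≤m+n x x′)) bel (≤-cert 0 h (solve (x ∷ x′ ∷ y ∷ y′ ∷ [])))
... | inj₂ h = below-ratio (≤-trans 1≤x (m≤m+n x x′)) bel′ (≤-cert 0 h (solve (x ∷ x′ ∷ y ∷ y′ ∷ [])))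

above-mediant : ∀ {x y x′ y′} → 1 ≤ x → 1 ≤ x′ → Above x y → Above x′ y′ → Above (x + x′) (y + y′)
above-mediant {x} {y} {x′} {y′} 1≤x 1≤x′ abo abo′ with ≤-total (x′ * y) (y′ * x)
... | inj₁ h = above-ratio 1≤x (≤-trans 1≤x (m≤m+n x x′)) abo (≤-cert 0 h (solve (x ∷ x′ ∷ y ∷ y′ ∷ [])))
... | inj₂ h = above-ratio 1≤x′ (≤-trans 1≤x (m≤m+n x x′)) abo′ (≤-cert 0 h (solve (x ∷ x′ ∷ y ∷ y′ ∷ [])))

below-antimono : ∀ {x y y′} → 1 ≤ x → y′ ≤ y → Below x y → Below x y′
below-antimono {x} 1≤x y′≤y bel = below-ratio 1≤x bel (*-monoˡ-≤ x y′≤y)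

above-mono : ∀ {x y y′} → 1 ≤ x → y ≤ y′ → Above x y → Above x y′
above-mono {x} {y} {y′} 1≤x y≤y′ abo = above-ratio 1≤x 1≤x abo (≤-trans (≤-reflexive (*-comm x y)) (*-monoˡ-≤ x y≤y′))

four-squares : ∀ n m → 4 * (n * n + n * m) ≡ 4 * (n * n) + 2 * n * (2 * m)
four-squares = solve-∀

double-square : ∀ m → 4 * (m * m) ≡ 2 * m * (2 * m)
double-square = solve-∀

-- Multiplying by 4 completes the square: m² < n² + n m turns into (2m - n)² < 5n². For 2m ≤ n the
-- truncated difference is 0, hence the separate case.
below⇒√5 : ∀ {n m} → 1 ≤ n → Below n m → (2 * m ∸ n) ^ 2 < 5 * n ^ 2
below⇒√5 {n} {m} 1≤n (below bel) with ≤-total (2 * m) n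
... | inj₁ 2m≤n rewrite m≤n⇒m∸n≡0 2m≤n = *-mono-≤ {1} {5} (s≤s z≤n) (*-mono-≤ 1≤n (*-mono-≤ 1≤n ≤-refl))
... | inj₂ n≤2m with split≤ n≤2m
... | d , eq with *-monoʳ-< 4 bel
... | bel₄ rewrite four-squares n m | double-square m | eq | m+n∸m≡n n d = balance (square d n) bel₄
  where
  square : ∀ d n → 5 * (n * (n * 1)) + (n + d) * (n + d) ≡ d * (d * 1) + (4 * (n * n) + 2 * n * (n + d))
  square = solve-∀

above⇒√5 : ∀ {n m} → 1 ≤ n → Above n m → 5 * n ^ 2 < (2 * m ∸ n) ^ 2
above⇒√5 {n} {m} 1≤n abo@(above abo′) with split≤ (≤-trans (above⇒≤ 1≤n abo) (m≤m+n m (m + 0)))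
... | d , eq with *-monoʳ-< 4 abo′
... | abo₄ rewrite four-squares n m | double-square m | eq | m+n∸m≡n n d = balance (square d n) abo₄
  where
  square : ∀ d n → d * (d * 1) + (4 * (n * n) + 2 * n * (n + d)) ≡ 5 * (n * (n * 1)) + (n + d) * (n + d)
  square = solve-∀

-- Walks as combinations of Fibonacci numbers.

-- G k = F(k - 1) with F(-1) = 1, so a walk of length k + 1 has coefficients G k and G (suc k).
G : ℕ → ℕ
G zero = 1
G (suc zero) = 0
G (suc (suc k)) = G (suc k) + G k

G-positive : ∀ k → 1 ≤ G (2 + k)
G-positive zero = ≤-refl
G-positive (suc k) = ≤-trans (G-positive k) (m≤m+n (G (2 + k)) (G (suc k)))

walk-linear : ∀ a b k → walk a b (suc k) ≡ a * G k + b * G (suc k)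
walk-linear a b zero = sym (trans (cong₂ _+_ (*-identityʳ a) (*-zeroʳ b)) (+-identityʳ a))
walk-linear a b (suc zero) = sym (cong₂ _+_ (*-zeroʳ a) (*-identityʳ b))
walk-linear a b (suc (suc k)) =
  trans (cong₂ _+_ (walk-linear a b (suc k)) (walk-linear a b k)) (regroup a b (G k) (G (suc k)))
  where
  regroup : ∀ a b p q → a * q + b * (q + p) + (a * p + b * q) ≡ a * (q + p) + b * (q + p + q)
  regroup = solve-∀

walk-shift : ∀ a b k → walk b (a + b) (suc k) ≡ walk a b (suc (suc k))
walk-shift a b zero = refl
walk-shift a b (suc zero) = +-comm a b
walk-shift a b (suc (suc k)) = cong₂ _+_ (walk-shift a b (suc k)) (walk-shift a b k)

-- Dropping the first `e` terms cuts a walk that is too long down to a prescribed length.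
walk-advance : ∀ e l {a b} → 1 ≤ a → 1 ≤ b →
  ∃ λ a′ → ∃ λ b′ → 1 ≤ a′ × 1 ≤ b′ × walk a′ b′ (suc l) ≡ walk a b (e + suc l)
walk-advance zero l 1≤a 1≤b = _ , _ , 1≤a , 1≤b , refl
walk-advance (suc e) l {a} {b} 1≤a 1≤b
  with walk-advance e l {b} {a + b} 1≤b (≤-trans 1≤a (m≤m+n a b))
... | a′ , b′ , 1≤a′ , 1≤b′ , eq rewrite +-suc e l = a′ , b′ , 1≤a′ , 1≤b′ , trans eq (walk-shift a b (e + l))

-- Cassini's identity and the norm form.

-- By Cassini, Pos k says that the walk length k + 1 is odd and Neg k that it is even.
record Pos (k : ℕ) : Set where
  constructor pos
  field cassini : G k * G k + G k * G (suc k) ≡ suc (G (suc k) * G (suc k))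

record Neg (k : ℕ) : Set where
  constructor neg
  field cassini : suc (G k * G k + G k * G (suc k)) ≡ G (suc k) * G (suc k)

next-square : ∀ p q → p * p + p * q + q * (q + p) ≡ (q + p) * (q + p)
next-square = solve-∀

pos-suc : ∀ {k} → Pos k → Neg (suc k)
pos-suc {k} (pos c) = neg (trans (cong (_+ q * (q + p)) (sym c)) (next-square p q))
  where p = G k ; q = G (suc k)

neg-suc : ∀ {k} → Neg k → Pos (suc k)
neg-suc {k} (neg c) = pos (trans (cong (_+ q * (q + p)) (sym c)) (cong suc (next-square p q)))
  where p = G k ; q = G (suc k)

sign : ∀ k → Pos k ⊎ Neg k
sign zero = inj₁ (pos refl)
sign (suc k) with sign k
... | inj₁ p = inj₂ (pos-suc p)
... | inj₂ n = inj₁ (neg-suc n)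

¬pos∧neg : ∀ {k} → Pos k → ¬ Neg k
¬pos∧neg {k} (pos c) (neg d) = 1+n≰n (begin
  suc (G (suc k) * G (suc k))      ≤⟨ n≤1+n _ ⟩
  2 + G (suc k) * G (suc k)        ≡⟨ cong suc c ⟨
  suc (G k * G k + G k * G (suc k)) ≡⟨ d ⟩
  G (suc k) * G (suc k)            ∎)
  where open ≤-Reasoning

pos-pred : ∀ {k} → Pos (suc k) → Neg k
pos-pred {k} p with sign k
... | inj₁ p′ = contradiction (pos-suc p′) (¬pos∧neg p)
... | inj₂ n = n

neg-pred : ∀ {k} → Neg (suc k) → Pos k
neg-pred {k} n with sign k
... | inj₁ p = p
... | inj₂ n′ = contradiction n (¬pos∧neg (neg-suc n′))

-- This is multiplicativity of the norm x² + x y - y² of x + y φ, since (a + b φ)(p + q φ) = n + m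
-- φ; the negative terms are moved across.
quadratic : ∀ a b p q → let n = a * p + b * q ; m = a * q + b * (q + p) in
  n * n + n * m + ((a * a + a * b) * (q * q) + b * b * (p * p + p * q))
    ≡ m * m + ((a * a + a * b) * (p * p + p * q) + b * b * (q * q))
quadratic = solve-∀

module _ (a b k : ℕ) where
  private
    p = G k
    q = G (suc k)
    n = a * p + b * q
    m = a * q + b * (q + p)
    X = a * a + a * b
    Y = b * b

  -- By Cassini p + q φ has norm 1, so (n , m) and (a , b) have equal norms and lie on the same side
  -- of φ. In `neg-form` the norm is -1 and the sides are exchanged.
  pos-form : Pos k → n * n + n * m + Y ≡ m * m + X
  pos-form (pos c) = +-cancelʳ-≡ (X * (q * q) + Y * (q * q)) _ _ (begin
    n * n + n * m + Y + (X * (q * q) + Y * (q * q))   ≡⟨ expand (n * n + n * m) Y (X * (q * q)) (q * q) ⟩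
    n * n + n * m + (X * (q * q) + Y * suc (q * q))   ≡⟨ cong (λ t → n * n + n * m + (X * (q * q) + Y * t)) (sym c) ⟩
    n * n + n * m + (X * (q * q) + Y * (p * p + p * q)) ≡⟨ quadratic a b p q ⟩
    m * m + (X * (p * p + p * q) + Y * (q * q))       ≡⟨ cong (λ t → m * m + (X * t + Y * (q * q))) c ⟩
    m * m + (X * suc (q * q) + Y * (q * q))           ≡⟨ collect (m * m) X (q * q) (Y * (q * q)) ⟩
    m * m + X + (X * (q * q) + Y * (q * q))           ∎)
    where
    open ≡-Reasoning
    expand : ∀ N Y Z R → N + Y + (Z + Y * R) ≡ N + (Z + Y * (1 + R))
    expand = solve-∀
    collect : ∀ M X R Z → M + (X * (1 + R) + Z) ≡ M + X + (X * R + Z)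
    collect = solve-∀

  neg-form : Neg k → m * m + Y ≡ n * n + n * m + X
  neg-form (neg c) = sym (+-cancelʳ-≡ (X * P + Y * P) _ _ (begin
    n * n + n * m + X + (X * P + Y * P)   ≡⟨ collect (n * n + n * m) X P (Y * P) ⟩
    n * n + n * m + (X * suc P + Y * P)   ≡⟨ cong (λ t → n * n + n * m + (X * t + Y * P)) c ⟩
    n * n + n * m + (X * (q * q) + Y * P) ≡⟨ quadratic a b p q ⟩
    m * m + (X * P + Y * (q * q))         ≡⟨ cong (λ t → m * m + (X * P + Y * t)) (sym c) ⟩
    m * m + (X * P + Y * suc P)           ≡⟨ expand (m * m) Y (X * P) P ⟩
    m * m + Y + (X * P + Y * P)           ∎))
    where
    open ≡-Reasoning
    P = p * p + p * q
    expand : ∀ N Y Z R → N + (Z + Y * (1 + R)) ≡ N + Y + (Z + Y * R)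
    expand = solve-∀
    collect : ∀ M X R Z → M + X + (X * R + Z) ≡ M + (X * (1 + R) + Z)
    collect = solve-∀

  pos-below : Pos k → Below a b → Below n m
  pos-below s (below h) = below (balance (pos-form s) h)

  pos-below⁻¹ : Pos k → Below n m → Below a b
  pos-below⁻¹ s (below h) =
    below (balance (trans (+-comm X (m * m)) (trans (sym (pos-form s)) (+-comm _ Y))) h)

  neg-above : Neg k → Below a b → Above n m
  neg-above s (below h) = above (balance (neg-form s) h)

  neg-above⁻¹ : Neg k → Above n m → Below a b
  neg-above⁻¹ s (above h) =
    below (balance (trans (+-comm X _) (trans (sym (neg-form s)) (+-comm _ Y))) h)

-- Representations and change of scale.

record Rep (k n : ℕ) : Set where
  constructor rep
  field
    a b : ℕ
    1≤a : 1 ≤ a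
    a≤q : a ≤ G (suc k)
    1≤b : 1 ≤ b
    golden : Below a b
    sum : a * G k + b * G (suc k) ≡ n

two-steps : ∀ x y p q → x * (q + p) + y * (q + p + q) ≡ (x + y) * p + (x + y + y) * q
two-steps = solve-∀

-- The map (x , y) ↦ (2x - y , y - x), two steps back along a walk, fixes the slope φ and preserves
-- the sides of it. Moreover z < x, since z ≥ x would give z (x + z) ≥ x².
below-back : ∀ x z → Below x (x + z) → ∃ λ c → x ≡ c + z × 1 ≤ c × Below c z
below-back x z bel with suc z ≤? x
... | no z≮x = contradiction (below⇒excess x z bel)
        (≤⇒≯ (*-mono-≤ (≮⇒≥ z≮x) (m≤m+n x z)))
... | yes z<x with split≤ z<x
... | c , refl = suc c , cong suc (+-comm z c) , s≤s z≤n , below (balance (regroup z c) (below⇒excess x z bel))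
  where
  regroup : ∀ z c → (1 + c) * (1 + c) + (1 + c) * z + z * (1 + z + c + z) ≡ z * z + (1 + z + c) * (1 + z + c)
  regroup = solve-∀

below-forth : ∀ a b → Below a b → Below (a + b) (a + b + b)
below-forth a b (below h) = excess⇒below (a + b) b (balance (regroup a b) h)
  where
  regroup : ∀ a b → (a + b) * (a + b) + b * b ≡ b * (a + b + b) + (a * a + a * b)
  regroup = solve-∀

-- Two terms are prepended: the start (x , x + z) becomes (x - z , z), with the parity of the length
-- kept. Bounding `x` by the limit of the longer scale admits an `x` beyond the limit at `k`.
lift : ∀ {k x z n} → 1 ≤ z → x ≤ G (3 + k) → Below x (x + z) →
  x * G k + (x + z) * G (suc k) ≡ n → Rep (2 + k) n
lift {k} {x} {z} 1≤z x≤q bel eq with below-back x z bel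
... | c , refl , 1≤c , bel′ =
  rep c z 1≤c (≤-trans (m≤m+n c z) x≤q) 1≤z bel′ (trans (two-steps c z (G k) (G (suc k))) eq)

TwoStep : (ℕ → Set) → Set
TwoStep S = ∀ {k} → S k → S (2 + k)

pos-two-step : TwoStep Pos
pos-two-step s = neg-suc (pos-suc s)

neg-two-step : TwoStep Neg
neg-two-step s = pos-suc (neg-suc s)

above-two : ∀ {S} → TwoStep S → TwoStep λ k → 2 ≤ k × S k
above-two step (2≤k , s) = m≤n⇒m≤o+n 2 2≤k , step s

-- Iterating `lift` turns b < φ a into b ≤ a. Each round replaces b by b - a, so b itself bounds the
-- recursion.
reduce : ∀ {S : ℕ → Set} → TwoStep S → ∀ {k n} → S k → Rep k n →
  ∃ λ k′ → S k′ × Σ (Rep k′ n) λ r → Rep.b r ≤ Rep.a r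
reduce {S} step s r = go (Rep.b r) s r ≤-refl
  where
  go : ∀ fuel {k n} → S k → (r : Rep k n) → Rep.b r ≤ fuel → ∃ λ k′ → S k′ × Σ (Rep k′ n) λ r → Rep.b r ≤ Rep.a r
  go zero s r b≤0 = contradiction (≤-trans (Rep.1≤b r) b≤0) λ ()
  go (suc fuel) {k} s r b≤fuel with Rep.b r ≤? Rep.a r
  ... | yes b≤a = k , s , r , b≤a
  go (suc fuel) {k} s (rep a b 1≤a a≤q 1≤b bel eq) b≤fuel | no b≰a with split≤ (≰⇒> b≰a)
  ... | z , refl = go fuel (step s) r′ (≤-trans (≤-reflexive r′b) (≤-pred (≤-trans (s≤s (+-monoˡ-≤ z 1≤a)) b≤fuel)))
    where
    r′ : Rep (2 + k) _
    r′ = lift {k} {a} {suc z} (s≤s z≤n)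
      (≤-trans a≤q (≤-trans (m≤m+n (G (suc k)) (G k)) (m≤m+n _ (G (suc k)))))
      (subst (Below a) (sym (+-suc a z)) bel)
      (trans (cong (λ t → a * G k + t * G (suc k)) (+-suc a z)) eq)
    r′b : Rep.b r′ ≡ suc z
    r′b with below-back a (suc z) (subst (Below a) (sym (+-suc a z)) bel)
    ... | c , refl , _ = refl

-- Which walks are longest.

-- By Cassini, e is up to sign the difference of (p + q) e p and e q², both multiples of q.
coprime-divides : ∀ k e → G (suc k) ∣ e * G k → G (suc k) ∣ e
coprime-divides k e q∣ep with sign k
... | inj₁ (pos c) = ∣m+n∣m⇒∣n {m = e * (q * q)} (∣-trans q∣ep (divides (p + q) eq)) (divides (e * q) (sym (*-assoc e q q)))
  where
  p = G k
  q = G (suc k)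
  eq : e * (q * q) + e ≡ (p + q) * (e * p)
  eq = trans (trans (+-comm _ e) (sym (*-suc e (q * q)))) (trans (cong (e *_) (sym c)) (expand e p q))
    where
    expand : ∀ e p q → e * (p * p + p * q) ≡ (p + q) * (e * p)
    expand = solve-∀
... | inj₂ (neg c) = ∣m+n∣m⇒∣n {m = (p + q) * (e * p)} (divides (e * q) eq) (∣n⇒∣m*n (p + q) q∣ep)
  where
  p = G k
  q = G (suc k)
  eq : (p + q) * (e * p) + e ≡ e * q * q
  eq = trans (expand e p q) (trans (cong (e *_) c) (sym (*-assoc e q q)))
    where
    expand : ∀ e p q → (p + q) * (e * p) + e ≡ e * (1 + (p * p + p * q))
    expand = solve-∀


-- If c ≥ a, then d > c ≥ a ≥ b makes the left side larger. If c < a, equality forces q to divide (a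
-- - c) p, hence a - c, although 0 < a - c < a ≤ q.
slow-unique : ∀ {k a b c d} → a ≤ G (suc k) → b ≤ a → 1 ≤ c → c < d → 1 ≤ a →
  c * G k + d * G (suc k) ≢ a * G k + b * G (suc k)
slow-unique {k} {a} {b} {c} {d} a≤q b≤a 1≤c c<d 1≤a eq with suc c ≤? a
... | no c≮a = <-irrefl (sym eq) (begin-strict
    a * G k + b * G (suc k)  ≤⟨ +-mono-≤ (*-monoˡ-≤ (G k) a≤c) (*-monoˡ-≤ (G (suc k)) (≤-trans b≤a a≤c)) ⟩
    c * G k + c * G (suc k)  <⟨ +-monoʳ-< (c * G k) (*-monoˡ-< (G (suc k)) {{>-nonZero (≤-trans 1≤a a≤q)}} c<d) ⟩
    c * G k + d * G (suc k)  ∎)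
  where
  open ≤-Reasoning
  a≤c = ≮⇒≥ c≮a
... | yes c<a with split≤ c<a
... | e , refl = <-irrefl refl (begin-strict
    G (suc k)      ≤⟨ ∣⇒≤ (coprime-divides k (suc e) q∣ep) ⟩
    suc e          <⟨ s≤s (+-monoˡ-≤ e 1≤c) ⟩
    suc c + e      ≤⟨ a≤q ⟩
    G (suc k)      ∎)
  where
  open ≤-Reasoning
  regroup : ∀ c e p x → (1 + c + e) * p + x ≡ c * p + (x + (1 + e) * p)
  regroup = solve-∀
  q∣ep : G (suc k) ∣ suc e * G k
  q∣ep = ∣m+n∣m⇒∣n {m = b * G (suc k)}
    (divides d (+-cancelˡ-≡ (c * G k) _ _ (trans (sym (regroup c e (G k) (b * G (suc k)))) (sym eq))))
    (divides b refl)

slow : ∀ {k n} (r : Rep k n) → Rep.b r ≤ Rep.a r → IsSlowLength n (suc k)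
slow {k} (rep a b 1≤a a≤q 1≤b bel refl) b≤a =
  (a , b , 1≤a , 1≤b , s≤s z≤n , walk-linear a b k) , longest
  where
  longest : ∀ a′ b′ l → 1 ≤ a′ → 1 ≤ b′ → 1 ≤ l → walk a′ b′ l ≡ _ → l ≤ suc k
  longest a′ b′ l 1≤a′ 1≤b′ _ eq with l ≤? suc k
  ... | yes l≤s = l≤s
  ... | no l≰s with split≤ (≰⇒> l≰s)
  ... | e , refl with walk-advance e (suc k) 1≤a′ 1≤b′
  -- After the cut, n is term k + 2 of the walk from (x , y), so term k + 1 of the walk from (y , x
  -- + y), whose second coordinate is the larger.
  ... | x , y , 1≤x , 1≤y , eq′ = contradiction
    (trans (sym (walk-linear y (x + y) k)) (trans (walk-shift x y k) (trans eq′ (trans (cong (walk a′ b′) (+-comm e (2 + k))) eq))))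
    (slow-unique {k} a≤q b≤a 1≤y (+-monoˡ-≤ y 1≤x) 1≤a)

-- Down- and up-integers as classes.

-- The bound 2 ≤ k asks for length at least 3, which `slow≥3` guarantees for longest walks to n ≥ 2.
Class : (ℕ → Set) → ℕ → Set
Class S n = ∃ λ k → (2 ≤ k × S k) × Rep k n

advance : ℕ → ℕ → ℕ → ℕ
advance a b k = a * G (suc k) + b * G (2 + k)

slow⇒ordered : ∀ {n s a b} → IsSlowLength n (suc s) → 1 ≤ a → walk a b (suc s) ≡ n → b ≤ a
slow⇒ordered {n} {s} {a} {b} (_ , longest) 1≤a eq with b ≤? a
... | yes b≤a = b≤a
... | no b≰a with split≤ (≰⇒> b≰a)
... | e , refl = contradiction (longest (suc e) a (2 + s) (s≤s z≤n) 1≤a (s≤s z≤n)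
        (trans (sym (walk-shift (suc e) a s)) (trans (cong (λ t → walk a (suc t) (suc s)) (+-comm e a)) eq))) 1+n≰n

rep≥2 : ∀ {k n} → 2 ≤ k → Rep k n → 2 ≤ n
rep≥2 {suc (suc k)} 2≤k (rep a b 1≤a a≤q 1≤b bel refl) =
  +-mono-≤ (*-mono-≤ 1≤a (G-positive k)) (*-mono-≤ 1≤b (G-positive (suc k)))
rep≥2 {suc zero} (s≤s ())

slow≥3 : ∀ {n s} → 2 ≤ n → IsSlowLength n s → 3 ≤ s
slow≥3 {suc (suc n)} 2≤n (_ , longest) = longest 1 (suc n) 3 (s≤s z≤n) (s≤s z≤n) (s≤s z≤n) (+-comm (suc n) 1)
slow≥3 {suc zero} (s≤s ())

-- Trading q units of the first coordinate for p units of the second keeps n, while by `trade-next`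
-- and Cassini the next term changes by exactly one. This rules out a > q for a walk that continues
-- to the rounding.
trade : ∀ c p q b → (q + c) * p + b * q ≡ c * p + (b + p) * q
trade = solve-∀

trade-next : ∀ c p q b → (q + c) * q + b * (q + p) + (p * p + p * q) ≡ c * q + (b + p) * (q + p) + q * q
trade-next = solve-∀

module _ {k a b : ℕ} where
  private
    p = G k
    q = G (suc k)
    n = a * p + b * q
    m = advance a b k

  -- Cassini gives (m + 1) q - (q + p) n = q - a. So a ≤ q makes (m + 1) / n at least (q + p) / q,
  -- which exceeds φ. In `neg-floor` the signs are reversed.
  pos-ceiling : Pos k → 1 ≤ n → a ≤ q → 1 ≤ q → Above n (suc m)
  pos-ceiling s 1≤n a≤q 1≤q =
    above-ratio {q} {q + p} 1≤q 1≤n (above (≤-reflexive (Neg.cassini (pos-suc s))))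
      (≤-cert 0 a≤q (trans (expand a b p q) (trans (cong (λ t → a * t + rest) (sym (Pos.cassini s))) (collect a b p q))))
    where
    rest = b * q * (q + p) + q
    expand : ∀ a b p q → (1 + (a * q + b * (q + p))) * q + a ≡ a * (1 + q * q) + (b * q * (q + p) + q)
    expand = solve-∀
    collect : ∀ a b p q → a * (p * p + p * q) + (b * q * (q + p) + q) ≡ (a * p + b * q) * (q + p) + q + 0
    collect = solve-∀

  neg-floor : ∀ {m′} → suc m′ ≡ m → Neg k → 1 ≤ n → a ≤ q → Below n m′
  neg-floor {m′} m≡ s 1≤n a≤q =
    below-ratio {q} {q + p} 1≤n (below (≤-reflexive (sym (Pos.cassini (neg-suc s)))))
      (≤-cert 0 a≤q (trans (expand a b p q) (trans (cong (λ t → a * t + b * q * (q + p)) (Neg.cassini s))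
        (trans (collect a b p q) (trans (cong (_* q) (sym m≡)) (rotate m′ q))))))
    where
    expand : ∀ a b p q → (q + p) * (a * p + b * q) + a ≡ a * (1 + (p * p + p * q)) + b * q * (q + p)
    expand = solve-∀
    collect : ∀ a b p q → a * (q * q) + b * q * (q + p) ≡ (a * q + b * (q + p)) * q
    collect = solve-∀
    rotate : ∀ m q → (1 + m) * q ≡ m * q + q + 0
    rotate = solve-∀

class⇒InD : ∀ {n} → Class Pos n → InD n
class⇒InD {n} (k₀ , s₀ , r₀)
  with reduce {λ k → 2 ≤ k × Pos k} (above-two {Pos} pos-two-step) s₀ r₀
... | k , (2≤k , s) , r@(rep a b 1≤a a≤q 1≤b bel refl) , b≤a =
  2≤n , suc k , slow r b≤a , a , b , (1≤a , 1≤b , walk-linear a b k) ,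
  subst (IsFloorPhi n) (sym (walk-linear a b (suc k)))
    (<⇒≤ (below⇒√5 1≤n (pos-below a b k s bel)) , above⇒√5 1≤n (pos-ceiling {k} {a} {b} s 1≤n a≤q (≤-trans 1≤a a≤q)))
  where
  2≤n = rep≥2 2≤k r
  1≤n = ≤-trans (n≤1+n 1) 2≤n

class⇒InU : ∀ {n} → Class Neg n → InU n
class⇒InU {n} (k₀ , s₀ , r₀)
  with reduce {λ k → 2 ≤ k × Neg k} (above-two {Neg} neg-two-step) s₀ r₀
... | k , (2≤k , s) , r@(rep a b 1≤a a≤q 1≤b bel refl) , b≤a =
  2≤n , suc k , slow r b≤a , a , b , (1≤a , 1≤b , walk-linear a b k) ,
  subst (IsCeilPhi n) (sym (walk-linear a b (suc k)))
    (below⇒√5 1≤n (neg-floor {k} {a} {b} m≡ s 1≤n a≤q) , <⇒≤ (above⇒√5 1≤n (neg-above a b k s bel)))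
  where
  2≤n = rep≥2 2≤k r
  1≤n = ≤-trans (n≤1+n 1) 2≤n
  -- Positivity of the next term makes the truncated c - 1 of `IsCeilPhi` a true predecessor.
  m≡ : suc (advance a b k ∸ 1) ≡ advance a b k
  m≡ = suc-pred (advance a b k) {{>-nonZero (≤-trans (*-mono-≤ 1≤a (≤-trans 1≤a a≤q)) (m≤m+n _ _))}}

InD⇒slow : ∀ {n} → InD n → ∃ λ k → (2 ≤ k × Pos k) × IsSlowLength n (suc k) × Rep k n
InD⇒slow (2≤n , zero , slow , _) = contradiction (slow≥3 2≤n slow) λ ()
InD⇒slow {n} (2≤n , suc k , slow , a , b , (1≤a , 1≤b , eq) , floor)
  rewrite walk-linear a b (suc k) with sign k | trans (sym (walk-linear a b k)) eq
-- An even length would put the next term above φ n.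
... | inj₂ s | refl = contradiction (proj₁ floor)
        (<⇒≱ (above⇒√5 (≤-trans (n≤1+n 1) 2≤n) (neg-above a b k s (≤⇒below 1≤a (slow⇒ordered slow 1≤a eq)))))
... | inj₁ s | refl = k , (≤-pred (slow≥3 2≤n slow) , s) , slow ,
  rep a b 1≤a a≤q 1≤b (≤⇒below 1≤a (slow⇒ordered slow 1≤a eq)) refl
  where
  p = G k
  q = G (suc k)
  a≤q : a ≤ q
  a≤q with a ≤? q
  ... | yes a≤q = a≤q
  ... | no a≰q with split≤ (≰⇒> a≰q)
  -- For a > q the traded start is again a longest walk to n. Its next term is m + 1, still below φ
  -- n, so m is not the floor.
  ... | c , refl = contradiction (proj₂ floor) (<⇒≯ (below⇒√5 (≤-trans (n≤1+n 1) 2≤n)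
        (subst₂ Below n≡ m≡ (pos-below (suc c) (b + p) k s (≤⇒below (s≤s z≤n)
          (slow⇒ordered slow (s≤s z≤n) (trans (walk-linear (suc c) (b + p) k) n≡)))))))
    where
    n≡ : suc c * p + (b + p) * q ≡ (suc q + c) * p + b * q
    n≡ = trans (sym (trade (suc c) p q b)) (cong (λ t → t * p + b * q) (+-suc q c))
    m≡ : suc c * q + (b + p) * (q + p) ≡ suc ((suc q + c) * q + b * (q + p))
    m≡ = sym (+-cancelʳ-≡ (q * q) _ _ (trans (sym (+-suc _ (q * q)))
          (trans (cong₂ (λ t z → t * q + b * (q + p) + z) (sym (+-suc q c)) (sym (Pos.cassini s)))
          (trade-next (suc c) p q b))))

InU⇒slow : ∀ {n} → InU n → ∃ λ k → (2 ≤ k × Neg k) × IsSlowLength n (suc k) × Rep k n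
InU⇒slow (2≤n , zero , slow , _) = contradiction (slow≥3 2≤n slow) λ ()
InU⇒slow {n} (2≤n , suc k , slow , a , b , (1≤a , 1≤b , eq) , ceil)
  rewrite walk-linear a b (suc k) with sign k | trans (sym (walk-linear a b k)) eq
... | inj₁ s | refl = contradiction (proj₂ ceil)
        (<⇒≱ (below⇒√5 (≤-trans (n≤1+n 1) 2≤n) (pos-below a b k s (≤⇒below 1≤a (slow⇒ordered slow 1≤a eq)))))
... | inj₂ s | refl = k , (≤-pred (slow≥3 2≤n slow) , s) , slow ,
  rep a b 1≤a a≤q 1≤b (≤⇒below 1≤a (slow⇒ordered slow 1≤a eq)) refl
  where
  p = G k
  q = G (suc k)
  a≤q : a ≤ q
  a≤q with a ≤? q
  ... | yes a≤q = a≤q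
  ... | no a≰q with split≤ (≰⇒> a≰q)
  ... | c , refl = contradiction (proj₁ ceil) (<⇒≯ (above⇒√5 (≤-trans (n≤1+n 1) 2≤n)
        (subst₂ Above n≡ m≡ (neg-above (suc c) (b + p) k s (≤⇒below (s≤s z≤n)
          (slow⇒ordered slow (s≤s z≤n) (trans (walk-linear (suc c) (b + p) k) n≡)))))))
    where
    m = (suc q + c) * q + b * (q + p)
    n≡ : suc c * p + (b + p) * q ≡ (suc q + c) * p + b * q
    n≡ = trans (sym (trade (suc c) p q b)) (cong (λ t → t * p + b * q) (+-suc q c))
    m≡ : suc c * q + (b + p) * (q + p) ≡ m ∸ 1
    m≡ = cong pred (+-cancelʳ-≡ (p * p + p * q) _ m (trans (sym (+-suc _ (p * p + p * q)))
          (trans (cong (suc c * q + (b + p) * (q + p) +_) (Neg.cassini s))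
          (trans (sym (trade-next (suc c) p q b)) (cong (λ t → t * q + b * (q + p) + (p * p + p * q)) (+-suc q c))))))

InD⇒class : ∀ {n} → InD n → Class Pos n
InD⇒class d = let (k , s , _ , r) = InD⇒slow d in k , s , r

InU⇒class : ∀ {n} → InU n → Class Neg n
InU⇒class u = let (k , s , _ , r) = InU⇒slow u in k , s , r

slow-length-unique : ∀ {n s t} → IsSlowLength n s → IsSlowLength n t → s ≡ t
slow-length-unique ((a , b , 1≤a , 1≤b , 1≤s , eq) , max) ((a′ , b′ , 1≤a′ , 1≤b′ , 1≤t , eq′) , max′) =
  ≤-antisym (max′ a b _ 1≤a 1≤b 1≤s eq) (max a′ b′ _ 1≤a′ 1≤b′ 1≤t eq′)

-- The longest length is unique and its parity decides the side. Hence membership in one class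
-- certifies non-membership in the other.
¬InD∧InU : ∀ {n} → InD n → ¬ InU n
¬InD∧InU d u with InD⇒slow d | InU⇒slow u
... | k , (_ , s) , slow , _ | k′ , (_ , s′) , slow′ , _ with slow-length-unique slow slow′
... | refl = ¬pos∧neg s s′

-- Linear bounds and the minimal scale.

≤-absurd : ∀ {A B} k → A ≤ B → ¬ (A ≡ B + suc k)
≤-absurd {A} {B} k A≤B refl = <⇒≱ (m<m+n B (s≤s z≤n)) A≤B

-- The Fibonacci fraction 8/5 lies just below φ, so a failed golden bound still yields a linear
-- inequality.
¬below⇒8/5 : ∀ {x y} → 1 ≤ x → ¬ Below x y → 8 * x ≤ 5 * y
¬below⇒8/5 {x} {y} 1≤x ¬bel with ≤-total (8 * x) (5 * y)
... | inj₁ h = h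
... | inj₂ h = contradiction (below-ratio {5} {8} 1≤x (below ≤-refl) (≤-trans (≤-reflexive (*-comm y 5)) h)) ¬bel

below⇒≤2 : ∀ {x y} → 1 ≤ x → Below x y → y ≤ 2 * x
below⇒≤2 {x} {y} 1≤x bel with y ≤? 2 * x
... | yes h = h
... | no h = contradiction
        (above-ratio {1} {2} ≤-refl 1≤x (above ≤-refl)
          (≤-trans (≤-reflexive (*-comm x 2)) (≤-trans (<⇒≤ (≰⇒> h)) (≤-reflexive (sym (*-identityʳ y))))))
        (¬below∧above bel)

above⇒3/2≤ : ∀ {x y} → 1 ≤ x → Above x y → 3 * x ≤ 2 * y
above⇒3/2≤ {x} {y} 1≤x abo with ≤-total (3 * x) (2 * y)
... | inj₁ h = h
... | inj₂ h = contradiction abo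
        (¬below∧above (below-ratio {2} {3} 1≤x (below ≤-refl) (≤-trans (≤-reflexive (*-comm y 2)) h)))

-- While a + b fits under the limit two scales down, the start is replaced there by (a + b , a +
-- 2b). Where this stops, a + b is large or the scale is one of the lowest two; the steps by 3 and 5
-- rely on this.
minimal : ∀ {S : ℕ → Set} → (∀ {k} → S (2 + k) → S k) → ∀ j {n} → S (5 + j) → Rep (5 + j) n →
  ∃ λ i → S (5 + i) × Σ (Rep (5 + i) n) λ r → i ≤ 1 ⊎ G (4 + i) < Rep.a r + Rep.b r
minimal down zero s r = 0 , s , r , inj₁ z≤n
minimal down (suc zero) s r = 1 , s , r , inj₁ ≤-refl
minimal {S} down (suc (suc i)) s r@(rep a b 1≤a a≤q 1≤b bel eq) with a + b ≤? G (6 + i)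
... | no a+b≰q = 2 + i , s , r , inj₂ (≰⇒> a+b≰q)
... | yes a+b≤q = minimal {S} down i (down s)
        (rep (a + b) (a + b + b) (≤-trans 1≤a (m≤m+n a b)) a+b≤q (≤-trans 1≤b (m≤n+m b (a + b)))
          (below-forth a b bel) (trans (sym (two-steps a b (G (5 + i)) (G (6 + i)))) eq))

G4 : ∀ j → G (4 + j) ≡ 2 * G j + 3 * G (suc j)
G4 j = expand (G j) (G (suc j))
  where
  expand : ∀ u v → v + u + v + (v + u) ≡ 2 * u + 3 * v
  expand = solve-∀

G5 : ∀ j → G (5 + j) ≡ 3 * G j + 5 * G (suc j)
G5 j = expand (G j) (G (suc j))
  where
  expand : ∀ u v → v + u + v + (v + u) + (v + u + v) ≡ 3 * u + 5 * v
  expand = solve-∀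

G6 : ∀ j → G (6 + j) ≡ 5 * G j + 8 * G (suc j)
G6 j = expand (G j) (G (suc j))
  where
  expand : ∀ u v → v + u + v + (v + u) + (v + u + v) + (v + u + v + (v + u)) ≡ 5 * u + 8 * v
  expand = solve-∀

-- Adding `δ` times Cassini's identity, read as `suc w ≡ z`, produces the constant in each shift
-- identity.
cassini-shift : ∀ {X Y w z} δ → suc w ≡ z → X + δ * w ≡ Y + δ * z → X ≡ δ + Y
cassini-shift {X} {Y} {w} δ refl eq = +-cancelʳ-≡ (δ * w) X (δ + Y) (trans eq (regroup Y δ w))
  where
  regroup : ∀ Y δ w → Y + δ * (1 + w) ≡ δ + Y + δ * w
  regroup = solve-∀

-- Moving a representation.

-- Moves a representation along (-c , +d): either the first coordinate stays positive, or the pair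
-- (n′ , m′) lies on the wrong side of the line of slope (q + p) / q.
move : ∀ {k a b c d n′ m′} → let p = G k ; q = G (suc k) in
  n′ + c * p ≡ a * p + b * q + d * q →
  m′ + c * q ≡ advance a b k + d * (q + p) →
  (∃ λ e → a ≡ suc c + e × suc e * p + (b + d) * q ≡ n′ × advance (suc e) (b + d) k ≡ m′)
  ⊎ (∃ λ e → (q + p) * n′ + e * (p * p + p * q) ≡ m′ * q + e * (q * q))
move {k} {a} {b} {c} {d} {n′} {m′} n≡ m≡ with suc c ≤? a
... | yes c<a with split≤ c<a
... | e , refl = inj₁ (e , refl ,
        sym (+-cancelʳ-≡ (c * p) _ _ (trans n≡ (regroup c e b d p q))) ,
        sym (+-cancelʳ-≡ (c * q) _ _ (trans m≡ (regroup c e b d q (q + p)))))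
  where
  p = G k
  q = G (suc k)
  regroup : ∀ c e b d p q → (1 + c + e) * p + b * q + d * q ≡ (1 + e) * p + (b + d) * q + c * p
  regroup = solve-∀
move {k} {a} {b} {c} {d} {n′} {m′} n≡ m≡ | no c≮a with split≤ (≮⇒≥ c≮a)
... | e , refl = inj₂ (e , (begin
    (q + p) * n′ + e * (p * p + p * q)    ≡⟨ factor n′ e p q ⟩
    (q + p) * (n′ + e * p)                ≡⟨ cong ((q + p) *_) (cancel a e b d n′ p q n≡) ⟩
    (q + p) * ((b + d) * q)               ≡⟨ rotate (b + d) p q ⟩
    (b + d) * (q + p) * q                 ≡⟨ cong (_* q) (cancel a e b d m′ q (q + p) m≡) ⟨
    (m′ + e * q) * q                      ≡⟨ expand m′ e q ⟩
    m′ * q + e * (q * q)                  ∎))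
  where
  p = G k
  q = G (suc k)
  open ≡-Reasoning
  cancel : ∀ a e b d n p q → n + (a + e) * p ≡ a * p + b * q + d * q → n + e * p ≡ (b + d) * q
  cancel a e b d n p q h = +-cancelʳ-≡ (a * p) _ _ (trans (lhs a e n p) (trans h (rhs a b d p q)))
    where
    lhs : ∀ a e n p → n + e * p + a * p ≡ n + (a + e) * p
    lhs = solve-∀
    rhs : ∀ a b d p q → a * p + b * q + d * q ≡ (b + d) * q + a * p
    rhs = solve-∀
  factor : ∀ n e p q → (q + p) * n + e * (p * p + p * q) ≡ (q + p) * (n + e * p)
  factor = solve-∀
  rotate : ∀ f p q → (q + p) * (f * q) ≡ f * (q + p) * q
  rotate = solve-∀
  expand : ∀ m e q → (m + e * q) * q ≡ m * q + e * (q * q)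
  expand = solve-∀

-- By the norm form, the side of (n′ , m′) alone decides the golden bound for (a - c , b + d). If a
-- ≤ c, Cassini would give (q + p) n′ + (c - a) = m′ q, so m′ / n′ would be at least (q + p) / q,
-- which exceeds φ.
move-pos : ∀ {k n c d n′ m′} → Pos k → (r : Rep k n) → let open Rep r in
  n′ + c * G k ≡ n + d * G (suc k) →
  m′ + c * G (suc k) ≡ advance a b k + d * G (2 + k) →
  Below n′ m′ → Rep k n′
move-pos {k} {c = c} {d} {n′} {m′} s (rep a b 1≤a a≤q 1≤b _ refl) n≡ m≡ bel with move {k} {a} {b} {c} {d} n≡ m≡
... | inj₁ (e , refl , n′≡ , m′≡) = rep (suc e) (b + d) (s≤s z≤n) (≤-trans (s≤s (m≤n+m e c)) a≤q)
        (≤-trans 1≤b (m≤m+n b d)) (pos-below⁻¹ (suc e) (b + d) k s (subst₂ Below (sym n′≡) (sym m′≡) bel)) n′≡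
... | inj₂ (e , eq) = contradiction (above (≤-reflexive (Neg.cassini (pos-suc s))))
        (¬below∧above (below-ratio (≤-trans 1≤a a≤q) bel (≤-trans (m≤m+n _ e) (≤-reflexive
          (+-cancelʳ-≡ (e * (q * q)) _ _ (trans (+-assoc ((q + G k) * n′) e (e * (q * q))) (trans (cong ((q + G k) * n′ +_)
            (trans (sym (*-suc e (q * q))) (cong (e *_) (sym (Pos.cassini s))))) eq)))))))
  where q = G (suc k)

move-neg : ∀ {k n c d n′ m′} → Neg k → (r : Rep k n) → let open Rep r in 1 ≤ n′ →
  n′ + c * G k ≡ n + d * G (suc k) →
  m′ + c * G (suc k) ≡ advance a b k + d * G (2 + k) →
  Above n′ m′ → Rep k n′
move-neg {k} {c = c} {d} {n′} {m′} s (rep a b 1≤a a≤q 1≤b _ refl) 1≤n′ n≡ m≡ abo with move {k} {a} {b} {c} {d} n≡ m≡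
... | inj₁ (e , refl , n′≡ , m′≡) = rep (suc e) (b + d) (s≤s z≤n) (≤-trans (s≤s (m≤n+m e c)) a≤q)
        (≤-trans 1≤b (m≤m+n b d)) (neg-above⁻¹ (suc e) (b + d) k s (subst₂ Above (sym n′≡) (sym m′≡) abo)) n′≡
... | inj₂ (e , eq) = contradiction
        (above-ratio {n′} {m′} {q} {q + p} 1≤n′ (≤-trans 1≤a a≤q) abo (≤-trans (≤-reflexive (*-comm q m′)) (≤-trans (m≤m+n _ e) (≤-reflexive
          (+-cancelʳ-≡ (e * P) _ _ (trans (+-assoc (m′ * q) e (e * P)) (trans (cong (m′ * q +_)
            (trans (sym (*-suc e P)) (cong (e *_) (Neg.cassini s)))) (sym eq))))))))
        (¬below∧above (below (≤-reflexive (sym (Pos.cassini (neg-suc s))))))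
  where
  p = G k
  q = G (suc k)
  P = p * p + p * q

-- Shift identities at a given scale.

-- Scale k = 5 + j, so that p and q are the following combinations of u = G j and v = G (1 + j).
record Scale (p q u v : ℕ) : Set where
  constructor scale
  field
    p≡ : p ≡ 3 * u + 5 * v
    q≡ : q ≡ 5 * u + 8 * v

scaleG : ∀ j → Scale (G (5 + j)) (G (6 + j)) (G j) (G (suc j))
scaleG j = scale (G5 j) (G6 j)

-- Each identity below is a multiple of Cassini's; it gives the change of (a , b) that adds the subscript
-- to n (the primed one is the corresponding change of w_{s+1}).
module PosScale {p q u v} (S : Scale p q u v) (c : suc (u * u + u * v) ≡ v * v) where
  pos₃ : v * q ≡ 3 + (u + v) * p
  pos₃ with refl ← Scale.p≡ S | refl ← Scale.q≡ S = cassini-shift 3 c (solve (u ∷ v ∷ []))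

  pos₃′ : v * (q + p) ≡ 5 + (u + v) * q
  pos₃′ with refl ← Scale.p≡ S | refl ← Scale.q≡ S = cassini-shift 5 c (solve (u ∷ v ∷ []))

  pos₅ : v * p ≡ 5 + u * q
  pos₅ with refl ← Scale.p≡ S | refl ← Scale.q≡ S = cassini-shift 5 c (solve (u ∷ v ∷ []))

  pos₋₂ : (u + 2 * v) * p ≡ 2 + (u + v) * q
  pos₋₂ with refl ← Scale.p≡ S | refl ← Scale.q≡ S = cassini-shift 2 c (solve (u ∷ v ∷ []))

  pos₋₂′ : (u + 2 * v) * q ≡ 3 + (u + v) * (q + p)
  pos₋₂′ with refl ← Scale.p≡ S | refl ← Scale.q≡ S = cassini-shift 3 c (solve (u ∷ v ∷ []))

  u≤v : u ≤ v
  u≤v with u ≤? v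
  ... | yes h = h
  ... | no h = contradiction (≤-reflexive c) (<⇒≱ (s≤s (≤-trans (*-mono-≤ v≤u v≤u) (m≤m+n (u * u) (u * v)))))
    where v≤u = <⇒≤ (≰⇒> h)

module NegScale {p q u v} (S : Scale p q u v) (c : suc (v * v) ≡ u * u + u * v) where
  neg₅ : u * q ≡ 5 + v * p
  neg₅ with refl ← Scale.p≡ S | refl ← Scale.q≡ S = cassini-shift 5 c (solve (u ∷ v ∷ []))

  neg₃ : (u + v) * p ≡ 3 + v * q
  neg₃ with refl ← Scale.p≡ S | refl ← Scale.q≡ S = cassini-shift 3 c (solve (u ∷ v ∷ []))

  neg₂ : (u + v) * q ≡ 2 + (u + 2 * v) * p
  neg₂ with refl ← Scale.p≡ S | refl ← Scale.q≡ S = cassini-shift 2 c (solve (u ∷ v ∷ []))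

  neg₂′ : (u + v) * (q + p) ≡ 3 + (u + 2 * v) * q
  neg₂′ with refl ← Scale.p≡ S | refl ← Scale.q≡ S = cassini-shift 3 c (solve (u ∷ v ∷ []))

  neg₋₁ : (2 * u + 3 * v) * p ≡ 1 + (u + 2 * v) * q
  neg₋₁ with refl ← Scale.p≡ S | refl ← Scale.q≡ S = cassini-shift 1 c (solve (u ∷ v ∷ []))

  neg₋₁′ : (2 * u + 3 * v) * q ≡ 2 + (u + 2 * v) * (q + p)
  neg₋₁′ with refl ← Scale.p≡ S | refl ← Scale.q≡ S = cassini-shift 2 c (solve (u ∷ v ∷ []))

pos-scale : ∀ {j} → Pos (5 + j) → suc (G j * G j + G j * G (suc j)) ≡ G (suc j) * G (suc j)
pos-scale s = Neg.cassini (pos-pred (neg-pred (pos-pred (neg-pred (pos-pred s)))))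

neg-scale : ∀ {j} → Neg (5 + j) → suc (G (suc j) * G (suc j)) ≡ G j * G j + G j * G (suc j)
neg-scale s = sym (Pos.cassini (neg-pred (pos-pred (neg-pred (pos-pred (neg-pred s))))))

-- Steps by 3 or 5.

Minimal : ∀ j {n} → Rep (5 + j) n → Set
Minimal j r = j ≤ 1 ⊎ G (4 + j) < Rep.a r + Rep.b r

2≤5+ : ∀ {j} → 2 ≤ 5 + j
2≤5+ = s≤s (s≤s z≤n)

-- Raises (a , b) to (a + x , b - y), passing to the next scale when a + x exceeds q.
raise : ∀ {S : ℕ → Set} (step : TwoStep S) {k n δ x y} → 2 ≤ k → S k → (r : Rep k n) → let open Rep r in
  x * G k ≡ δ + y * G (suc k) →
  x ≤ G (2 + k) →
  (a + x ≤ G (suc k) → y < b) →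
  (G (suc k) < a + x → a + x + y < b) →
  Class S (δ + n)
raise {S} step {k} {δ = δ} {x} {y} 2≤k s (rep a b 1≤a a≤q 1≤b bel refl) x≡ x≤ low high
  with a + x ≤? G (suc k)
... | yes a+x≤q with split≤ (low a+x≤q)
... | z , refl = k , (2≤k , s) , rep (a + x) (suc z) (≤-trans 1≤a (m≤m+n a x)) a+x≤q (s≤s z≤n)
        (below-ratio (≤-trans 1≤a (m≤m+n a x)) bel (*-mono-≤ {suc z} {suc y + z} (s≤s (m≤n+m z y)) (m≤m+n a x)))
        (trans (expand a x z (G k) (G (suc k))) (trans (cong (_+ rest) x≡) (collect a y z δ (G k) (G (suc k)))))
  where
  rest = a * G k + (1 + z) * G (suc k)
  expand : ∀ a x z p q → (a + x) * p + (1 + z) * q ≡ x * p + (a * p + (1 + z) * q)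
  expand = solve-∀
  collect : ∀ a y z δ p q → δ + y * q + (a * p + (1 + z) * q) ≡ δ + (a * p + (1 + y + z) * q)
  collect = solve-∀
raise {S} step {k} {δ = δ} {x} {y} 2≤k s (rep a b 1≤a a≤q 1≤b bel refl) x≡ x≤ low high | no a+x≰q
  with split≤ (high (≰⇒> a+x≰q))
-- Here a + x overshoots q, but the new second coordinate b - y exceeds a + x, so `lift` applies and
-- the larger limit two scales up accommodates it.
... | z , refl = 2 + k , (≤-trans 2≤k (m≤n+m k 2) , step s) ,
        lift {k} {a + x} {suc z} (s≤s z≤n)
          (≤-trans (+-mono-≤ a≤q x≤) (≤-reflexive (+-comm (G (suc k)) _)))
          (below-ratio (≤-trans 1≤a (m≤m+n a x)) bel (*-mono-≤ {a + x + suc z} (≤-cert y (z≤n {0}) (size (a + x) y z)) (m≤m+n a x)))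
          (trans (expand a x z (G k) (G (suc k))) (trans (cong (_+ rest) x≡) (collect a x y z δ (G k) (G (suc k)))))
  where
  size : ∀ w y z → 1 + (w + y) + z + 0 ≡ w + (1 + z) + 0 + y
  size = solve-∀
  rest = a * G k + (a + x + (1 + z)) * G (suc k)
  expand : ∀ a x z p q → (a + x) * p + (a + x + (1 + z)) * q ≡ x * p + (a * p + (a + x + (1 + z)) * q)
  expand = solve-∀
  collect : ∀ a x y z δ p q → δ + y * q + (a * p + (a + x + (1 + z)) * q) ≡ δ + (a * p + (1 + (a + x + y) + z) * q)
  collect = solve-∀

-- Lowers (a , b) to (a - x , b + y) while the ratio stays below φ; otherwise a is small relative to b.
lower : ∀ {S : ℕ → Set} {k n δ x y} → 2 ≤ k → S k → (r : Rep k n) → let open Rep r in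
  y * G (suc k) ≡ δ + x * G k →
  Class S (δ + n) ⊎ 8 * a ≤ 5 * (b + y) + 8 * x
lower {k = k} {δ = δ} {x} {y} 2≤k s (rep a b 1≤a a≤q 1≤b bel refl) y≡ with suc x ≤? a
... | no x≮a = inj₂ (≤-trans (*-monoʳ-≤ 8 (≮⇒≥ x≮a)) (m≤n+m (8 * x) (5 * (b + y))))
... | yes x<a with split≤ x<a
... | z , refl with below? (suc z) (b + y)
... | yes bel′ = inj₁ (k , (2≤k , s) , rep (suc z) (b + y) (s≤s z≤n) (≤-trans (s≤s (m≤n+m z x)) a≤q)
        (≤-trans 1≤b (m≤m+n b y)) bel′ (trans (expand b y z (G k) (G (suc k))) (trans (cong (_+ rest) y≡) (collect x z b δ (G k) (G (suc k))))))
  where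
  rest = (1 + z) * G k + b * G (suc k)
  expand : ∀ b y z p q → (1 + z) * p + (b + y) * q ≡ y * q + ((1 + z) * p + b * q)
  expand = solve-∀
  collect : ∀ x z b δ p q → δ + x * p + ((1 + z) * p + b * q) ≡ δ + ((1 + x + z) * p + b * q)
  collect = solve-∀
... | no ¬bel = inj₂ (≤-cert 0 (¬below⇒8/5 (s≤s z≤n) ¬bel) (size x z (b + y)))
  where
  size : ∀ x z c → 5 * c + 8 * x + 8 * (1 + z) ≡ 8 * (1 + x + z) + 5 * c + 0
  size = solve-∀

G6≤ : ∀ j {x} → x ≤ 5 * G j + 8 * G (suc j) → x ≤ G (7 + j)
G6≤ j h = ≤-trans (≤-trans h (≤-reflexive (sym (G6 j)))) (m≤m+n (G (6 + j)) (G (5 + j)))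

-- `small` is what a failed `lower` leaves, and `large` is minimality of the scale. Assuming b ≤ u,
-- the weights 8, 1, 13, 5 on the hypotheses cancel a and b and leave a contradiction.
pos-low : ∀ u v a b → u ≤ v → 8 * a ≤ 5 * (b + v) + 8 * (u + v) → 2 * u + 3 * v < a + b → u < b
pos-low u v a b u≤v small large = ≰⇒> λ b≤u → ≤-absurd (7 + 6 * v)
  (+-mono-≤ (+-mono-≤ (+-mono-≤ (*-monoʳ-≤ 8 large) small) (*-monoʳ-≤ 13 b≤u)) (*-monoʳ-≤ 5 u≤v))
  (cert u v a b)
  where
  cert : ∀ u v a b → 8 * (1 + (2 * u + 3 * v)) + 8 * a + 13 * b + 5 * u
    ≡ 8 * (a + b) + (5 * (b + v) + 8 * (u + v)) + 13 * u + 5 * v + (1 + (7 + 6 * v))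
  cert = solve-∀

-- Here `large` says that adding v carries a past q = 5u + 8v; the weights 3, 1, 5 cancel a and b.
pos-high : ∀ u v a b → 8 * a ≤ 5 * (b + v) + 8 * (u + v) → 5 * u + 8 * v < a + v → a + v + u < b
pos-high u v a b small large = ≰⇒> λ b≤ → ≤-absurd (2 + 2 * u + 3 * v)
  (+-mono-≤ (+-mono-≤ (*-monoʳ-≤ 3 large) small) (*-monoʳ-≤ 5 b≤)) (cert u v a b)
  where
  cert : ∀ u v a b → 3 * (1 + (5 * u + 8 * v)) + 8 * a + 5 * b
    ≡ 3 * (a + v) + (5 * (b + v) + 8 * (u + v)) + 5 * (a + v + u) + (1 + (2 + 2 * u + 3 * v))
  cert = solve-∀

neg-low : ∀ u v a b → 8 * a ≤ 5 * (b + u) + 8 * v → 2 * u + 3 * v < a + b → v < b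
neg-low u v a b small large = ≰⇒> λ b≤v → ≤-absurd (7 + 11 * u + 3 * v)
  (+-mono-≤ (+-mono-≤ (*-monoʳ-≤ 8 large) small) (*-monoʳ-≤ 13 b≤v)) (cert u v a b)
  where
  cert : ∀ u v a b → 8 * (1 + (2 * u + 3 * v)) + 8 * a + 13 * b
    ≡ 8 * (a + b) + (5 * (b + u) + 8 * v) + 13 * v + (1 + (7 + 11 * u + 3 * v))
  cert = solve-∀

neg-high : ∀ u v a b → 8 * a ≤ 5 * (b + u) + 8 * v → 5 * u + 8 * v < a + (u + v) → a + (u + v) + v < b
neg-high u v a b small large = ≰⇒> λ b≤ → ≤-absurd (2 + 2 * u + 3 * v)
  (+-mono-≤ (+-mono-≤ (*-monoʳ-≤ 3 large) small) (*-monoʳ-≤ 5 b≤)) (cert u v a b)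
  where
  cert : ∀ u v a b → 3 * (1 + (5 * u + 8 * v)) + 8 * a + 5 * b
    ≡ 3 * (a + (u + v)) + (5 * (b + u) + 8 * v) + 5 * (a + (u + v) + v) + (1 + (2 + 2 * u + 3 * v))
  cert = solve-∀

-- Lowering by (u + v , v) adds 3. If that is impossible, a is so small against b that raising by (v
-- , u) succeeds and adds 5. In `step-neg` lowering adds 5 and raising adds 3.
step-pos : ∀ {n} j → Pos (5 + j) → (r : Rep (5 + j) n) → Minimal j r → Class Pos (3 + n) ⊎ Class Pos (5 + n)
step-pos {n} j s r min
  with lower {Pos} {x = G j + G (suc j)} {G (suc j)} 2≤5+ s r (PosScale.pos₃ (scaleG j) (pos-scale s))
... | inj₁ cl = inj₁ cl
... | inj₂ small = inj₂ (raise {Pos} pos-two-step {x = v} {u} 2≤5+ s r pos₅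
        (G6≤ j (≤-trans (m≤m+n v _) (m≤n+m (8 * v) (5 * u))))
        (λ _ → low min)
        (λ h → pos-high u v a b small (subst (_< a + v) (G6 j) h)))
  where
  open PosScale (scaleG j) (pos-scale s)
  open Rep r
  u = G j
  v = G (suc j)
  -- Of the two lowest scales Cassini's sign leaves only j = 1, where u = 0.
  base : ∀ j → suc (G j * G j + G j * G (suc j)) ≡ G (suc j) * G (suc j) → j ≤ 1 → G j < b
  base zero ()
  base (suc zero) _ _ = 1≤b
  base (suc (suc _)) _ (s≤s ())
  low : Minimal j r → u < b
  low (inj₁ j≤1) = base j (pos-scale s) j≤1
  low (inj₂ h) = pos-low u v a b u≤v small (subst (_< a + b) (G4 j) h)

step-neg : ∀ {n} j → Neg (5 + j) → (r : Rep (5 + j) n) → Minimal j r → Class Neg (3 + n) ⊎ Class Neg (5 + n)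
step-neg {n} j s r min
  with lower {Neg} {x = G (suc j)} {G j} 2≤5+ s r (NegScale.neg₅ (scaleG j) (neg-scale s))
... | inj₁ cl = inj₂ cl
... | inj₂ small = inj₁ (raise {Neg} neg-two-step {x = u + v} {v} 2≤5+ s r neg₃
        (G6≤ j (+-mono-≤ (m≤m+n u _) (m≤m+n v _)))
        (λ _ → low min)
        (λ h → neg-high u v a b small (subst (_< a + (u + v)) (G6 j) h)))
  where
  open NegScale (scaleG j) (neg-scale s)
  open Rep r
  u = G j
  v = G (suc j)
  base : ∀ j → suc (G (suc j) * G (suc j)) ≡ G j * G j + G j * G (suc j) → j ≤ 1 → G (suc j) < b
  base zero _ _ = 1≤b
  base (suc zero) ()
  base (suc (suc _)) _ (s≤s ())
  low : Minimal j r → v < b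
  low (inj₁ j≤1) = base j (neg-scale s) j≤1
  low (inj₂ h) = neg-low u v a b small (subst (_< a + b) (G4 j) h)

-- Excluding the gap 4.

-- Since 4φ lies between 6 and 7, the split is whether M - m reaches 7. If so, removing (1 , 2) from
-- (4 + n , 7 + m) lowers the slope, as m ≤ 2n. If not, M - 3 ≤ m + 3, and adding (2 , 3) to (n , m)
-- stays below φ.
link-pos : ∀ {n m M} → 1 ≤ n → Below n m → Below (4 + n) M → Below (3 + n) (5 + m) ⊎ Below (2 + n) (M ∸ 3)
link-pos {n} {m} {M} 1≤n bel bel′ with 7 + m ≤? M
... | yes 7+m≤M = inj₁ (below-ratio (s≤s z≤n) (below-antimono (s≤s z≤n) 7+m≤M bel′)
        (≤-cert 1 (below⇒≤2 1≤n bel) (cert n m)))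
  where
  cert : ∀ n m → (7 + m) * (3 + n) + m ≡ (5 + m) * (4 + n) + 2 * n + 1
  cert = solve-∀
... | no 7+m≰M = inj₂ (below-antimono (s≤s z≤n) (∸-monoˡ-≤ 3 (≤-pred (≰⇒> 7+m≰M)))
        (below-mediant {2} {3} (s≤s z≤n) (below ≤-refl) bel))

-- Either (3 , 5), of slope above φ, is added to (n , m), or (2 , 3) is removed from (4 + n , 6 +
-- m), which does not lower the slope because 3/2 ≤ m / n.
link-neg : ∀ {n m M} → 1 ≤ n → Above n m → Above (4 + n) M → Above (2 + n) (3 + m) ⊎ Above (3 + n) (M ∸ 2)
link-neg {n} {m} {M} 1≤n abo abo′ with 7 + m ≤? M
... | yes 7+m≤M = inj₂ (above-mono (s≤s z≤n) (∸-monoˡ-≤ 2 7+m≤M)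
        (above-mediant {3} {5} (s≤s z≤n) 1≤n (above ≤-refl) abo))
... | no 7+m≰M = inj₁ (above-ratio (s≤s z≤n) (s≤s z≤n) (above-mono (s≤s z≤n) (≤-pred (≰⇒> 7+m≰M)) abo′)
        (≤-cert 0 (above⇒3/2≤ 1≤n abo) (cert n m)))
  where
  cert : ∀ n m → (3 + m) * (4 + n) + 3 * n ≡ (2 + n) * (6 + m) + 2 * m + 0
  cert = solve-∀

move-up : ∀ δ n {X Y} → X ≡ δ + Y → δ + n + Y ≡ n + X
move-up δ n {Y = Y} refl = trans (cong (_+ Y) (+-comm δ n)) (+-assoc n δ Y)

move-down : ∀ δ n {X Y} → X ≡ δ + Y → n + X ≡ δ + n + Y
move-down δ n eq = sym (move-up δ n eq)

-- Makes the truncated M - 3 and M - 2 of the link lemmas true subtractions.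
advance≥3 : ∀ {j n} (r : Rep (5 + j) n) → 3 ≤ advance (Rep.a r) (Rep.b r) (5 + j)
advance≥3 {j} (rep a b 1≤a a≤q 1≤b _ _) = +-mono-≤ {1} {_} {2}
  (*-mono-≤ 1≤a (G-positive (4 + j)))
  (*-mono-≤ 1≤b (+-mono-≤ (G-positive (4 + j)) (G-positive (3 + j))))

next : ∀ {k n} → Rep k n → ℕ
next {k} r = advance (Rep.a r) (Rep.b r) k

rep-below : ∀ {k n} → Pos k → (r : Rep k n) → Below n (next r)
rep-below {k} s (rep a b _ _ _ bel refl) = pos-below a b k s bel

rep-above : ∀ {k n} → Neg k → (r : Rep k n) → Above n (next r)
rep-above {k} s (rep a b _ _ _ bel refl) = neg-above a b k s bel

-- One outcome moves n up by 3 at its scale, the other moves n + 4 down by 2 at its own; the scales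
-- may differ. In `bridge-neg` the moves are 2 up and 1 down.
bridge-pos : ∀ {n} j i → Pos (5 + j) → Pos (5 + i) → Rep (5 + j) n → Rep (5 + i) (4 + n) →
  Class Pos (3 + n) ⊎ Class Pos (2 + n)
bridge-pos {n} j i s t r r′ with link-pos (≤-trans (n≤1+n 1) (rep≥2 2≤5+ r)) (rep-below s r) (rep-below t r′)
... | inj₁ bel = inj₁ (5 + j , (2≤5+ , s) , move-pos {c = u + v} {v} s r
        (move-up 3 n pos₃) (move-up 5 (next r) pos₃′) bel)
  where
  open PosScale (scaleG j) (pos-scale s)
  u = G j
  v = G (suc j)
... | inj₂ bel = inj₂ (5 + i , (2≤5+ , t) , move-pos {c = u + 2 * v} {u + v} t r′
        (move-down 2 (2 + n) pos₋₂)
        (trans (move-down 3 (next r′ ∸ 3) pos₋₂′) (cong (_+ (u + v) * G (7 + i)) (m+[n∸m]≡n (advance≥3 r′)))) bel)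
  where
  open PosScale (scaleG i) (pos-scale t)
  u = G i
  v = G (suc i)

bridge-neg : ∀ {n} j i → Neg (5 + j) → Neg (5 + i) → Rep (5 + j) n → Rep (5 + i) (4 + n) →
  Class Neg (3 + n) ⊎ Class Neg (2 + n)
bridge-neg {n} j i s t r r′ with link-neg (≤-trans (n≤1+n 1) (rep≥2 2≤5+ r)) (rep-above s r) (rep-above t r′)
... | inj₁ abo = inj₂ (5 + j , (2≤5+ , s) , move-neg {c = u + 2 * v} {u + v} s r (s≤s z≤n)
        (move-up 2 n neg₂) (move-up 3 (next r) neg₂′) abo)
  where
  open NegScale (scaleG j) (neg-scale s)
  u = G j
  v = G (suc j)
... | inj₂ abo = inj₁ (5 + i , (2≤5+ , t) , move-neg {c = 2 * u + 3 * v} {u + 2 * v} t r′ (s≤s z≤n)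
        (move-down 1 (3 + n) neg₋₁)
        (trans (move-down 2 (next r′ ∸ 2) neg₋₁′)
          (cong (_+ (u + 2 * v) * G (7 + i)) (m+[n∸m]≡n (≤-trans (n≤1+n 2) (advance≥3 r′))))) abo)
  where
  open NegScale (scaleG i) (neg-scale t)
  u = G i
  v = G (suc i)

-- Small members, and nearby members in general.

Near : (ℕ → Set) → ℕ → Set
Near P n = P (1 + n) ⊎ P (2 + n) ⊎ P (3 + n)

concrete : ∀ {S : ℕ → Set} k a b {_ : True (2 ≤? k)} {_ : True (1 ≤? a)} {_ : True (a ≤? G (suc k))}
  {_ : True (1 ≤? b)} {_ : True (below? a b)} →
  S k → Class S (a * G k + b * G (suc k))
concrete k a b {h} {i} {j} {l} {m} s =
  k , (toWitness h , s) , rep a b (toWitness i) (toWitness j) (toWitness l) (toWitness m) refl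

Big : (ℕ → Set) → ℕ → Set
Big S n = ∃ λ j → S (5 + j) × Rep (5 + j) n

-- The members of each class whose longest walk has length at most 5.
data SmallDown : ℕ → Set where
  d₂ : SmallDown 2
  d₅ : SmallDown 5
  d₇ : SmallDown 7
  d₉ : SmallDown 9
  d₁₀ : SmallDown 10
  d₁₂ : SmallDown 12
  d₁₅ : SmallDown 15

data SmallUp : ℕ → Set where
  u₃ : SmallUp 3
  u₄ : SmallUp 4
  u₆ : SmallUp 6

-- Reducing to b ≤ a first leaves only finitely many starts with k below 5.
classify-pos : ∀ {n} → Class Pos n → SmallDown n ⊎ Big Pos n
classify-pos (k₀ , s₀ , r₀)
  with reduce {λ k → 2 ≤ k × Pos k} (above-two {Pos} pos-two-step) s₀ r₀
... | 2 , _ , rep 1 1 _ _ _ _ refl , _ = inj₁ d₂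
... | 4 , _ , rep 1 1 _ _ _ _ refl , _ = inj₁ d₅
... | 4 , _ , rep 2 1 _ _ _ _ refl , _ = inj₁ d₇
... | 4 , _ , rep 2 2 _ _ _ _ refl , _ = inj₁ d₁₀
... | 4 , _ , rep 3 1 _ _ _ _ refl , _ = inj₁ d₉
... | 4 , _ , rep 3 2 _ _ _ _ refl , _ = inj₁ d₁₂
... | 4 , _ , rep 3 3 _ _ _ _ refl , _ = inj₁ d₁₅
... | suc (suc (suc (suc (suc j)))) , (_ , s) , r , _ = inj₂ (j , s , r)
... | 1 , (s≤s () , _) , _
... | 3 , (_ , pos ()) , _
... | 2 , _ , rep (suc (suc _)) _ _ (s≤s ()) _ _ _ , _
... | 2 , _ , rep 1 (suc (suc _)) _ _ _ _ _ , s≤s ()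
... | 4 , _ , rep (suc (suc (suc (suc _)))) _ _ (s≤s (s≤s (s≤s ()))) _ _ _ , _
... | 4 , _ , rep 1 (suc (suc _)) _ _ _ _ _ , s≤s ()
... | 4 , _ , rep 2 (suc (suc (suc _))) _ _ _ _ _ , s≤s (s≤s ())
... | 4 , _ , rep 3 (suc (suc (suc (suc _)))) _ _ _ _ _ , s≤s (s≤s (s≤s ()))

classify-neg : ∀ {n} → Class Neg n → SmallUp n ⊎ Big Neg n
classify-neg (k₀ , s₀ , r₀)
  with reduce {λ k → 2 ≤ k × Neg k} (above-two {Neg} neg-two-step) s₀ r₀
... | 3 , _ , rep 1 1 _ _ _ _ refl , _ = inj₁ u₃
... | 3 , _ , rep 2 1 _ _ _ _ refl , _ = inj₁ u₄
... | 3 , _ , rep 2 2 _ _ _ _ refl , _ = inj₁ u₆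
... | suc (suc (suc (suc (suc j)))) , (_ , s) , r , _ = inj₂ (j , s , r)
... | 1 , (s≤s () , _) , _
... | 2 , (_ , neg ()) , _
... | 4 , (_ , neg ()) , _
... | 3 , _ , rep (suc (suc (suc _))) _ _ (s≤s (s≤s ())) _ _ _ , _
... | 3 , _ , rep 1 (suc (suc _)) _ _ _ _ _ , s≤s ()
... | 3 , _ , rep 2 (suc (suc (suc _))) _ _ _ _ _ , s≤s (s≤s ())

near-down : ∀ {n} → SmallDown n → Near (Class Pos) n
near-down d₂ = inj₂ (inj₂ (concrete 4 1 1 (pos refl)))
near-down d₅ = inj₂ (inj₁ (concrete 4 2 1 (pos refl)))
near-down d₇ = inj₂ (inj₁ (concrete 4 3 1 (pos refl)))
near-down d₉ = inj₁ (concrete 4 2 2 (pos refl))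
near-down d₁₀ = inj₂ (inj₁ (concrete 4 3 2 (pos refl)))
near-down d₁₂ = inj₁ (concrete 6 1 1 (pos refl))
near-down d₁₅ = inj₂ (inj₂ (concrete 6 2 1 (pos refl)))

before-down : ∀ {n} → SmallDown (4 + n) → Near (Class Pos) n
before-down d₅ = inj₁ (concrete 2 1 1 (pos refl))
before-down d₇ = inj₂ (inj₁ (concrete 4 1 1 (pos refl)))
before-down d₉ = inj₂ (inj₁ (concrete 4 2 1 (pos refl)))
before-down d₁₀ = inj₁ (concrete 4 2 1 (pos refl))
before-down d₁₂ = inj₁ (concrete 4 3 1 (pos refl))
before-down d₁₅ = inj₁ (concrete 4 3 2 (pos refl))

near-up : ∀ {n} → SmallUp n → Near (Class Neg) n
near-up u₃ = inj₁ (concrete 3 2 1 (neg refl))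
near-up u₄ = inj₂ (inj₁ (concrete 3 2 2 (neg refl)))
near-up u₆ = inj₂ (inj₁ (concrete 5 1 1 (neg refl)))

before-up : ∀ {n} → SmallUp (4 + n) → Near (Class Neg) n
before-up u₄ = inj₂ (inj₂ (concrete 3 1 1 (neg refl)))
before-up u₆ = inj₁ (concrete 3 1 1 (neg refl))

successor-pos : ∀ {n} → Class Pos n → Near (Class Pos) n ⊎ Class Pos (5 + n)
successor-pos c with classify-pos c
... | inj₁ d = inj₁ (near-down d)
... | inj₂ (j₀ , s₀ , r₀) with minimal {Pos} (λ s → neg-pred (pos-pred s)) j₀ s₀ r₀
... | j , s , r , min with step-pos j s r min
... | inj₁ c₃ = inj₁ (inj₂ (inj₂ c₃))
... | inj₂ c₅ = inj₂ c₅

successor-neg : ∀ {n} → Class Neg n → Near (Class Neg) n ⊎ Class Neg (5 + n)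
successor-neg c with classify-neg c
... | inj₁ d = inj₁ (near-up d)
... | inj₂ (j₀ , s₀ , r₀) with minimal {Neg} (λ s → pos-pred (neg-pred s)) j₀ s₀ r₀
... | j , s , r , min with step-neg j s r min
... | inj₁ c₃ = inj₁ (inj₂ (inj₂ c₃))
... | inj₂ c₅ = inj₂ c₅

between-pos : ∀ {n} → Class Pos n → Class Pos (4 + n) → Near (Class Pos) n
between-pos c c′ with classify-pos c | classify-pos c′
... | inj₁ d | _ = near-down d
... | inj₂ _ | inj₁ d = before-down d
... | inj₂ (j , s , r) | inj₂ (i , t , r′) with bridge-pos j i s t r r′
... | inj₁ c₃ = inj₂ (inj₂ c₃)
... | inj₂ c₂ = inj₂ (inj₁ c₂)

between-neg : ∀ {n} → Class Neg n → Class Neg (4 + n) → Near (Class Neg) n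
between-neg c c′ with classify-neg c | classify-neg c′
... | inj₁ d | _ = near-up d
... | inj₂ _ | inj₁ d = before-up d
... | inj₂ (j , s , r) | inj₂ (i , t , r′) with bridge-neg j i s t r r′
... | inj₁ c₃ = inj₂ (inj₂ c₃)
... | inj₂ c₂ = inj₂ (inj₁ c₂)

-- Consecutive gaps.

module Gaps {P C : ℕ → Set} (class⇒in : ∀ {n} → C n → P n) (in⇒class : ∀ {n} → P n → C n)
  (successor : ∀ {n} → C n → Near C n ⊎ C (5 + n)) (between : ∀ {n} → C n → C (4 + n) → Near C n) where

  unbounded : ∀ {n} → C (suc n) → Unbounded P
  unbounded {n} c m = let (n′ , m<n′ , c′) = go m in n′ , m<n′ , class⇒in c′
    where
    after : ∀ {m n} → m < n → C n → ∃ λ n′ → suc m < n′ × C n′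
    after {m} {n} m<n c with successor c
    ... | inj₁ (inj₁ c′) = 1 + n , s≤s m<n , c′
    ... | inj₁ (inj₂ (inj₁ c′)) = 2 + n , s≤s (m≤n⇒m≤o+n 1 m<n) , c′
    ... | inj₁ (inj₂ (inj₂ c′)) = 3 + n , s≤s (m≤n⇒m≤o+n 2 m<n) , c′
    ... | inj₂ c′ = 5 + n , s≤s (m≤n⇒m≤o+n 4 m<n) , c′
    go : ∀ m → ∃ λ n′ → m < n′ × C n′
    go zero = suc n , s≤s z≤n , c
    go (suc m) = let (n′ , m<n′ , c′) = go m in after m<n′ c′

  skipped : ∀ {x g} → (∀ z → x < z → z < x + g → ¬ P z) → ∀ i → 1 ≤ i → i < g → ¬ C (i + x)
  skipped {x} {g} none i 1≤i i<g c =
    none (i + x) (+-monoˡ-≤ x 1≤i) (≤-trans (+-monoˡ-≤ x i<g) (≤-reflexive (+-comm g x))) (class⇒in c)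

  ¬near : ∀ {x g} → (∀ z → x < z → z < x + (4 + g) → ¬ P z) → ¬ Near C x
  ¬near none (inj₁ c) = skipped none 1 ≤-refl (s≤s (s≤s z≤n)) c
  ¬near none (inj₂ (inj₁ c)) = skipped none 2 (s≤s z≤n) (s≤s (s≤s (s≤s z≤n))) c
  ¬near none (inj₂ (inj₂ c)) = skipped none 3 (s≤s z≤n) (s≤s (s≤s (s≤s (s≤s z≤n)))) c

  gap⇒1235 : ∀ g → IsConsecutiveGap P g → In1235 g
  gap⇒1235 0 (() , _)
  gap⇒1235 1 _ = inj₁ refl
  gap⇒1235 2 _ = inj₂ (inj₁ refl)
  gap⇒1235 3 _ = inj₂ (inj₂ (inj₁ refl))
  gap⇒1235 5 _ = inj₂ (inj₂ (inj₂ refl))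
  gap⇒1235 4 (_ , x , px , px′ , none) =
    contradiction (between (in⇒class px) (subst C (+-comm x 4) (in⇒class px′))) (¬near none)
  gap⇒1235 (suc (suc (suc (suc (suc (suc g)))))) (_ , x , px , _ , none) with successor (in⇒class px)
  ... | inj₁ near = contradiction near (¬near none)
  ... | inj₂ c₅ = contradiction c₅ (skipped none 5 (s≤s z≤n) (m≤m+n 6 g))

  witness : ∀ x g → 1 ≤ g → C x → C (x + g) → (∀ i → suc i < g → ¬ P (suc x + i)) → IsConsecutiveGap P g
  witness x g 1≤g c c′ none = 1≤g , x , class⇒in c , class⇒in c′ , skip
    where
    skip : ∀ z → x < z → z < x + g → ¬ P z
    skip z x<z z<x+g with split≤ x<z
    ... | i , refl = none i (+-cancelˡ-< x (suc i) g (≤-trans (s≤s (≤-reflexive (+-suc x i))) z<x+g))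

module Down = Gaps {InD} {Class Pos} class⇒InD InD⇒class successor-pos between-pos
module Up = Gaps {InU} {Class Neg} class⇒InU InU⇒class successor-neg between-neg

-- Realising the gaps 1, 2, 3 and 5.

not-down : ∀ {n} → Class Neg n → ¬ InD n
not-down c d = ¬InD∧InU d (class⇒InU c)

not-up : ∀ {n} → Class Pos n → ¬ InU n
not-up c = ¬InD∧InU (class⇒InD c)

-- The gaps begin at 9, 5, 2 and 18. Each skipped integer is represented at a scale of the opposite
-- parity, which excludes it by disjointness.
down-gap : ∀ g → In1235 g → IsConsecutiveGap InD g
down-gap _ (inj₁ refl) = Down.witness 9 1 ≤-refl (concrete 4 3 1 (pos refl)) (concrete 4 2 2 (pos refl))
  λ { _ (s≤s ()) }
down-gap _ (inj₂ (inj₁ refl)) = Down.witness 5 2 (s≤s z≤n) (concrete 4 1 1 (pos refl)) (concrete 4 2 1 (pos refl))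
  λ { 0 _ → not-down (concrete 3 2 2 (neg refl))
    ; (suc _) (s≤s (s≤s ())) }
down-gap _ (inj₂ (inj₂ (inj₁ refl))) = Down.witness 2 3 (s≤s z≤n) (concrete 2 1 1 (pos refl)) (concrete 4 1 1 (pos refl))
  λ { 0 _ → not-down (concrete 3 1 1 (neg refl))
    ; 1 _ → not-down (concrete 3 2 1 (neg refl))
    ; (suc (suc _)) (s≤s (s≤s (s≤s ()))) }
down-gap _ (inj₂ (inj₂ (inj₂ refl))) = Down.witness 18 5 (s≤s z≤n) (concrete 6 2 1 (pos refl)) (concrete 6 3 1 (pos refl))
  λ { 0 _ → not-down (concrete 5 3 2 (neg refl))
    ; 1 _ → not-down (concrete 5 5 1 (neg refl))
    ; 2 _ → not-down (concrete 7 1 1 (neg refl))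
    ; 3 _ → not-down (concrete 5 4 2 (neg refl))
    ; (suc (suc (suc (suc _)))) (s≤s (s≤s (s≤s (s≤s (s≤s ()))))) }

up-gap : ∀ g → In1235 g → IsConsecutiveGap InU g
up-gap _ (inj₁ refl) = Up.witness 3 1 ≤-refl (concrete 3 1 1 (neg refl)) (concrete 3 2 1 (neg refl))
  λ { _ (s≤s ()) }
up-gap _ (inj₂ (inj₁ refl)) = Up.witness 4 2 (s≤s z≤n) (concrete 3 2 1 (neg refl)) (concrete 3 2 2 (neg refl))
  λ { 0 _ → not-up (concrete 4 1 1 (pos refl))
    ; (suc _) (s≤s (s≤s ())) }
up-gap _ (inj₂ (inj₂ (inj₁ refl))) = Up.witness 8 3 (s≤s z≤n) (concrete 5 1 1 (neg refl)) (concrete 5 2 1 (neg refl))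
  λ { 0 _ → not-up (concrete 4 3 1 (pos refl))
    ; 1 _ → not-up (concrete 4 2 2 (pos refl))
    ; (suc (suc _)) (s≤s (s≤s (s≤s ()))) }
up-gap _ (inj₂ (inj₂ (inj₂ refl))) = Up.witness 45 5 (s≤s z≤n) (concrete 7 4 1 (neg refl)) (concrete 7 3 2 (neg refl))
  λ { 0 _ → not-up (concrete 6 6 2 (pos refl))
    ; 1 _ → not-up (concrete 8 2 1 (pos refl))
    ; 2 _ → not-up (concrete 6 8 1 (pos refl))
    ; 3 _ → not-up (concrete 6 5 3 (pos refl))
    ; (suc (suc (suc (suc _)))) (s≤s (s≤s (s≤s (s≤s (s≤s ()))))) }

theorem6 : (Unbounded InD × Unbounded InU)
    × (∀ (g : ℕ) → IsConsecutiveGap InD g ⇔ In1235 g)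
    × (∀ (g : ℕ) → IsConsecutiveGap InU g ⇔ In1235 g)
theorem6 =
  (Down.unbounded (concrete 2 1 1 (pos refl)) , Up.unbounded (concrete 3 1 1 (neg refl)))
  , (λ g → mk⇔ (Down.gap⇒1235 g) (down-gap g))
  , (λ g → mk⇔ (Up.gap⇒1235 g) (up-gap g))
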